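{- Let $(F_n)_{n\ge1}$ be the Fibonacci numbers $F_1=1$, $F_2=2$, $F_n=F_{n-1}+F_{n-2}$ for $n\ge3$. For each of the following sets $P$ of five generalized patterns, $|S_n(P)|=F_n$ for every $n\ge1$: $\{1\text{ - }23,2\text{ - }13,1\text{ - }32,21\text{ - }3,12\text{ - }3\}$, $\{1\text{ - }23,2\text{ - }13,13\text{ - }2,21\text{ - }3,12\text{ - }3\}$, $\{1\text{ - }23,2\text{ - }13,13\text{ - }2,1\text{ - }32,21\text{ - }3\}$, $\{1\text{ - }23,13\text{ - }2,31\text{ - }2,3\text{ - }12,1\text{ - }32\}$.
   Context: $S_n$ is the set of permutations $\pi=\pi_1\pi_2\cdots\pi_n$ of $\{1,\dots,n\}$. For $abc$ a permutation of $123$, the generalized pattern $a\text{ - }bc$ is contained in $\pi$ if there are indices $i<j$ with $j+1\le n$ such that $\pi_i\pi_j\pi_{j+1}$ is order-isomorphic to $abc$; the generalized pattern $ab\text{ - }c$ is contained in $\pi$ if there are indices $i,k$ with $i+1<k\le n$ such that $\pi_i\pi_{i+1}\pi_k$ is order-isomorphic to $abc$. (Letters not separated by a dash must occur in adjacent positions; letters separated by a dash need not be adjacent.) $\pi$ avoids a pattern if it does not contain it. For a set $P$ of generalized patterns, $S_n(P)$ is the set of $\pi\in S_n$ avoiding every pattern in $P$. -}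

module Defs where

open import Data.Fin.Base using (Fin; toℕ; _<_)
open import Data.Fin.Permutation using (Permutation′; _⟨$⟩ʳ_; _≈_)
open import Data.List.Base using (List)
open import Data.List.Relation.Unary.All using (All)
open import Data.Nat.Base as ℕ using (ℕ; zero; suc; _+_)
open import Data.Product.Base using (Σ; ∃-syntax; _×_; proj₁)
open import Data.Vec.Functional using (Vector; []; _∷_)
open import Function.Bundles using (Inverse; _⇔_)
open import Level using (0ℓ; _⊔_)
open import Relation.Binary.Bundles using (Setoid)
open import Relation.Binary.PropositionalEquality
  using (_≡_; refl; sym; trans; setoid)
open import Relation.Nullary.Negation using (¬_)

-- F 0 is not part of the sequence F 1 = 1, F 2 = 2, …; its value is the one
-- for which the recurrence yields F 2 = 2.
F : ℕ → ℕ
F zero          = 1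
F (suc zero)    = 1
F (suc (suc n)) = F (suc n) + F n

OrderIsomorphic : ∀ {k} → Vector ℕ k → Vector ℕ k → Set
OrderIsomorphic u v = ∀ i j → u i ℕ.< u j ⇔ v i ℕ.< v j

-- a -[ b · c ] is the pattern written a-bc, and [ a · b ]- c is ab-c: the
-- bracketed letters must occur in adjacent positions.
infix 6 _-[_·_] [_·_]-_

data Pattern : Set where
  _-[_·_] : (a b c : ℕ) → Pattern
  [_·_]-_ : (a b c : ℕ) → Pattern

-- Positions and values are numbered from 0.
letter : ∀ {n} → Permutation′ n → Fin n → ℕ
letter π i = toℕ (π ⟨$⟩ʳ i)

Contains : ∀ {n} → Permutation′ n → Pattern → Set
Contains π (a -[ b · c ]) =
  ∃[ i ] ∃[ j ] ∃[ j′ ] i < j × toℕ j′ ≡ suc (toℕ j) ×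
    OrderIsomorphic (letter π i ∷ letter π j ∷ letter π j′ ∷ []) (a ∷ b ∷ c ∷ [])
Contains π ([ a · b ]- c) =
  ∃[ i ] ∃[ i′ ] ∃[ k ] toℕ i′ ≡ suc (toℕ i) × i′ < k ×
    OrderIsomorphic (letter π i ∷ letter π i′ ∷ letter π k ∷ []) (a ∷ b ∷ c ∷ [])

Avoids : ∀ {n} → Permutation′ n → Pattern → Set
Avoids π p = ¬ Contains π p

-- Two elements are equal when they are the same permutation
-- (pointwise), irrespective of the proofs they carry.
S : ℕ → List Pattern → Setoid 0ℓ 0ℓ
S n P = record
  { Carrier       = Σ (Permutation′ n) λ π → All (Avoids π) P
  ; _≈_           = λ x y → proj₁ x ≈ proj₁ y
  ; isEquivalence = record
    { refl  = λ _ → refl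
    ; sym   = λ π≈ρ i → sym (π≈ρ i)
    ; trans = λ π≈ρ ρ≈σ i → trans (π≈ρ i) (ρ≈σ i)
    }
  }

HasCardinality : ∀ {a ℓ} → Setoid a ℓ → ℕ → Set (a ⊔ ℓ)
HasCardinality A k = Inverse A (setoid (Fin k))

{-# OPTIONS --safe #-}

-- Read every permutation from right to left.  Each reversed set of patterns
-- then forces the least value to occur in one of the first two positions, and
-- in the second position only when the first carries one prescribed value: the
-- second least one for the first three sets, the greatest one for the last.
-- Conversely, prefixing a permutation by such a beginning creates no pattern.
-- Deleting the beginning gives the Fibonacci recurrence.

module Submission where

open import Defs
open import Data.Bool.Base using (T)
open import Data.Fin.Base as Fin using (Fin; toℕ; fromℕ; inject₁; opposite; punchIn)
open import Data.Fin.Patterns using (0F; 1F; 2F)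
import Data.Fin.Properties as Fin
open import Data.Fin.Permutation
  using (Permutation′; _⟨$⟩ʳ_; _⟨$⟩ˡ_; _≈_; inverseˡ; inverseʳ; _∘ₚ_; reverse; id;
         remove; insert; lift₀; lift₀-remove; punchIn-permute)
open import Data.List.Base using (List; []; _∷_; map)
open import Data.List.Membership.Propositional using (_∈_)
open import Data.List.Relation.Unary.All as All using (All; []; _∷_)
import Data.List.Relation.Unary.All.Properties as All
open import Data.List.Relation.Unary.Any using (here; there)
open import Data.Nat.Base as ℕ using (ℕ; zero; suc; _≤_; _<_; _<ᵇ_; z≤n; s≤s; _∸_)
import Data.Nat.Properties as ℕ
open import Data.Product.Base using (∃; ∃-syntax; _×_; _,_; proj₂)
open import Data.Sum.Base using (inj₁; inj₂)
open import Data.Sum.Function.Setoid using (_⊎-inverse_)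
open import Data.Sum.Relation.Binary.Pointwise as Pointwise
  using (_⊎ₛ_; Pointwise-≡↔≡)
import Data.Vec.Functional as Vector
open Vector using (Vector)
open import Function.Base using (_∘_)
open import Function.Bundles using (Inverse; Bijection; Equivalence; _⇔_; mk⇔)
import Function.Consequences.Setoid as Consequences
import Function.Construct.Composition as Composition
import Function.Construct.Symmetry as Symmetry
open import Function.Properties.Bijection using (Bijection⇒Inverse)
open import Function.Properties.Inverse using (↔-sym)
open import Relation.Binary.Bundles using (Setoid)
open import Relation.Binary.Definitions using (tri<; tri≈; tri>)
open import Relation.Binary.PropositionalEquality
  using (_≡_; _≢_; refl; sym; trans; cong; subst; subst₂)
open import Relation.Nullary.Decidable using (True; toWitness; _→-dec_)
open import Relation.Nullary.Negation using (¬_; contradiction)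

private
  variable
    k n : ℕ
    p : Pattern
    Q : List Pattern

⟨_,_,_⟩ : ∀ {A : Set} → A → A → A → Vector A 3
⟨ x , y , z ⟩ = x Vector.∷ y Vector.∷ z Vector.∷ Vector.[]

-- Order isomorphism

-- The entries of `v` are pairwise distinct, which is decided by evaluation, so by trichotomy the
-- implications from `v` to `u` already give the converse ones. Phrasing the premise with `<ᵇ` makes
-- it compute to the empty type for literal entries in the wrong order.
orderIsomorphic : (u v : Vector ℕ k) →
  {True (Fin.all? λ i → Fin.all? λ j → (v i ℕ.≟ v j) →-dec (i Fin.≟ j))} →
  (∀ i j → T (v i <ᵇ v j) → u i < u j) → OrderIsomorphic u v
orderIsomorphic u v {inj} mono i j = mk⇔ reflect (mono i j ∘ ℕ.<⇒<ᵇ)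
  where
  reflect : u i < u j → v i < v j
  reflect ui<uj with ℕ.<-cmp (v i) (v j)
  ... | tri< vi<vj _ _ = vi<vj
  ... | tri> _ _ vj<vi = contradiction (mono j i (ℕ.<⇒<ᵇ vj<vi)) (ℕ.<-asym ui<uj)
  ... | tri≈ _ vi≡vj _ rewrite toWitness inj i j vi≡vj =
    contradiction ui<uj (ℕ.<-irrefl refl)

module _ {x y z : ℕ} (x<y : x < y) (y<z : y < z) where

  iso321 : OrderIsomorphic ⟨ z , y , x ⟩ ⟨ 3 , 2 , 1 ⟩
  iso321 = orderIsomorphic _ _ λ where
    1F 0F _ → y<z
    2F 0F _ → ℕ.<-trans x<y y<z
    2F 1F _ → x<y
    0F 2F ()
    1F 2F ()
    2F 2F ()

  iso231 : OrderIsomorphic ⟨ y , z , x ⟩ ⟨ 2 , 3 , 1 ⟩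
  iso231 = orderIsomorphic _ _ λ where
    0F 1F _ → y<z
    2F 0F _ → x<y
    2F 1F _ → ℕ.<-trans x<y y<z
    0F 2F ()
    2F 2F ()

  iso312 : OrderIsomorphic ⟨ z , x , y ⟩ ⟨ 3 , 1 , 2 ⟩
  iso312 = orderIsomorphic _ _ λ where
    1F 0F _ → ℕ.<-trans x<y y<z
    1F 2F _ → x<y
    2F 0F _ → y<z
    0F 1F ()
    0F 2F ()
    2F 2F ()

  iso213 : OrderIsomorphic ⟨ y , x , z ⟩ ⟨ 2 , 1 , 3 ⟩
  iso213 = orderIsomorphic _ _ λ where
    0F 2F _ → y<z
    1F 0F _ → x<y
    1F 2F _ → ℕ.<-trans x<y y<z
    2F 0F ()
    2F 1F ()
    2F 2F ()

-- A triple applied to a variable index is stuck; this moves `f` outside so that hypotheses about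
-- `f` apply.
lookup-triple : ∀ {A B : Set} (f : A → B) x y z i →
  ⟨ f x , f y , f z ⟩ i ≡ f (⟨ x , y , z ⟩ i)
lookup-triple f x y z 0F = refl
lookup-triple f x y z 1F = refl
lookup-triple f x y z 2F = refl

triple-transfer : ∀ {A : Set} {f g : A → ℕ} {v} → (∀ x y → f x < f y ⇔ g x < g y) →
  ∀ x y z → OrderIsomorphic ⟨ f x , f y , f z ⟩ v →
  OrderIsomorphic ⟨ g x , g y , g z ⟩ v
triple-transfer {f = f} {g} f⇔g x y z iso i j
  rewrite lookup-triple g x y z i | lookup-triple g x y z j
  with iso i j
... | e rewrite lookup-triple f x y z i | lookup-triple f x y z j =
  mk⇔ (Equivalence.to e ∘ Equivalence.from (f⇔g _ _))
      (Equivalence.to (f⇔g _ _) ∘ Equivalence.from e)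

reverse-triple : ∀ {x y z : ℕ} i → ⟨ x , y , z ⟩ (opposite i) ≡ ⟨ z , y , x ⟩ i
reverse-triple 0F = refl
reverse-triple 1F = refl
reverse-triple 2F = refl

triple-reverse : ∀ {x y z a b c} →
  OrderIsomorphic ⟨ x , y , z ⟩ ⟨ a , b , c ⟩ →
  OrderIsomorphic ⟨ z , y , x ⟩ ⟨ c , b , a ⟩
triple-reverse {x} {y} {z} {a} {b} {c} iso i j
  with iso (opposite i) (opposite j)
... | e rewrite reverse-triple {x} {y} {z} i | reverse-triple {x} {y} {z} j
              | reverse-triple {a} {b} {c} i | reverse-triple {a} {b} {c} j = e

-- Reversal

-- The pattern read from right to left; the adjacent pair changes sides with the dash.
rev : Pattern → Pattern
rev (a -[ b · c ]) = [ c · b ]- a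
rev ([ a · b ]- c) = c -[ b · a ]

rev-involutive : ∀ p → rev (rev p) ≡ p
rev-involutive (a -[ b · c ]) = refl
rev-involutive ([ a · b ]- c) = refl

opposite-mono-< : {i j : Fin n} → i Fin.< j → opposite j Fin.< opposite i
opposite-mono-< {i = i} {j} i<j
  rewrite Fin.opposite-prop i | Fin.opposite-prop j =
  ℕ.∸-monoʳ-< (s≤s i<j) (Fin.toℕ<n j)

opposite-suc : {i j : Fin n} → toℕ j ≡ suc (toℕ i) →
  toℕ (opposite i) ≡ suc (toℕ (opposite j))
opposite-suc {n} {i} {j} j≡1+i
  rewrite Fin.opposite-prop i | Fin.opposite-prop j | sym j≡1+i =
  ℕ.+-∸-assoc 1 (Fin.toℕ<n j)

-- `opposite` reverses the order of positions and keeps neighbours adjacent, so the mirrored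
-- positions, listed backwards, carry the reversed occurrence.
contains-reverse : ∀ (π ρ : Permutation′ n) → (∀ i → ρ ⟨$⟩ʳ opposite i ≡ π ⟨$⟩ʳ i) →
  ∀ p → Contains π p → Contains ρ (rev p)
contains-reverse π ρ eq (a -[ b · c ]) (i , j , j′ , i<j , adj , iso) =
  opposite j′ , opposite j , opposite i , opposite-suc adj , opposite-mono-< i<j ,
  iso′
  where
  iso′ : OrderIsomorphic
    ⟨ letter ρ (opposite j′) , letter ρ (opposite j) , letter ρ (opposite i) ⟩
    ⟨ c , b , a ⟩
  iso′ rewrite eq i | eq j | eq j′ = triple-reverse iso
contains-reverse π ρ eq ([ a · b ]- c) (i , i′ , k , adj , i′<k , iso) =
  opposite k , opposite i′ , opposite i , opposite-mono-< i′<k , opposite-suc adj ,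
  iso′
  where
  iso′ : OrderIsomorphic
    ⟨ letter ρ (opposite k) , letter ρ (opposite i′) , letter ρ (opposite i) ⟩
    ⟨ c , b , a ⟩
  iso′ rewrite eq i | eq i′ | eq k = triple-reverse iso

avoids-reverse : (π : Permutation′ n) → All (Avoids π) (map rev Q) →
  All (Avoids (reverse ∘ₚ π)) Q
avoids-reverse π avoids = All.map
  (λ avoid contains → avoid (contains-reverse (reverse ∘ₚ π) π (λ _ → refl) _ contains))
  (All.map⁻ avoids)

avoids-reverse⁻ : (π : Permutation′ n) → All (Avoids π) Q →
  All (Avoids (reverse ∘ₚ π)) (map rev Q)
avoids-reverse⁻ π avoids = All.map⁺ (All.map
  (λ {p} avoid contains → avoid (subst (Contains π) (rev-involutive p)
    (contains-reverse (reverse ∘ₚ π) π (λ _ → refl) (rev p) contains)))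
  avoids)

S-reverse : ∀ n Q → Inverse (S n (map rev Q)) (S n Q)
S-reverse n Q = record
  { to        = λ (π , avoids) → reverse ∘ₚ π , avoids-reverse π avoids
  ; from      = λ (π , avoids) → reverse ∘ₚ π , avoids-reverse⁻ π avoids
  ; to-cong   = λ π≈ρ i → π≈ρ (opposite i)
  ; from-cong = λ π≈ρ i → π≈ρ (opposite i)
  ; inverse   =
      (λ {(x , _)} y≈x i → trans (y≈x (opposite i)) (cong (x ⟨$⟩ʳ_) (Fin.opposite-involutive i)))
    , (λ {(x , _)} y≈x i → trans (y≈x (opposite i)) (cong (x ⟨$⟩ʳ_) (Fin.opposite-involutive i)))
  }

-- Deleting the first letter

-- Forgets the dash: several obstructions below depend on the order of the entries alone.
entries : Pattern → Vector ℕ 3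
entries (a -[ b · c ]) = ⟨ a , b , c ⟩
entries ([ a · b ]- c) = ⟨ a , b , c ⟩

-- An occurrence that uses the first letter. The other two positions are numbered within the tail,
-- hence `toℕ i ≡ 0` for adjacency to the first letter.
BeginsWith : Permutation′ (suc n) → Pattern → Set
BeginsWith π (a -[ b · c ]) =
  ∃[ j ] ∃[ j′ ] toℕ j′ ≡ suc (toℕ j) ×
    OrderIsomorphic ⟨ letter π 0F , letter π (Fin.suc j) , letter π (Fin.suc j′) ⟩
                    ⟨ a , b , c ⟩
BeginsWith π ([ a · b ]- c) =
  ∃[ i ] ∃[ k ] toℕ i ≡ 0 × i Fin.< k ×
    OrderIsomorphic ⟨ letter π 0F , letter π (Fin.suc i) , letter π (Fin.suc k) ⟩
                    ⟨ a , b , c ⟩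

punchIn-<⇔ : ∀ i (j k : Fin n) → punchIn i j Fin.< punchIn i k ⇔ j Fin.< k
punchIn-<⇔ i j k = mk⇔
  (λ lt → ℕ.≰⇒> λ k≤j → ℕ.<⇒≱ lt (Fin.punchIn-mono-≤ i k j k≤j))
  (λ lt → ℕ.≰⇒> λ k≤j → ℕ.<⇒≱ lt (Fin.punchIn-cancel-≤ i k j k≤j))

module _ (π : Permutation′ (suc n)) (τ : Permutation′ n) {x : Fin (suc n)}
         (tail : ∀ i → π ⟨$⟩ʳ Fin.suc i ≡ punchIn x (τ ⟨$⟩ʳ i)) where

  private
    tail⇔ : ∀ i j → letter π (Fin.suc i) < letter π (Fin.suc j) ⇔ letter τ i < letter τ j
    tail⇔ i j rewrite tail i | tail j = punchIn-<⇔ x _ _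

    tail⇔⁻ : ∀ i j → letter τ i < letter τ j ⇔ letter π (Fin.suc i) < letter π (Fin.suc j)
    tail⇔⁻ i j = mk⇔ (Equivalence.from (tail⇔ i j)) (Equivalence.to (tail⇔ i j))

  -- The tail of `π` is `τ` with its values relabelled to skip `x`. Since `punchIn x` preserves and
  -- reflects order, occurrences in `τ` shift by one position.
  contains-tail⁻ : ∀ p → Contains τ p → Contains π p
  contains-tail⁻ (a -[ b · c ]) (i , j , j′ , i<j , adj , iso) =
    Fin.suc i , Fin.suc j , Fin.suc j′ , s≤s i<j , cong suc adj ,
    triple-transfer tail⇔⁻ i j j′ iso
  contains-tail⁻ ([ a · b ]- c) (i , i′ , k , adj , i′<k , iso) =
    Fin.suc i , Fin.suc i′ , Fin.suc k , cong suc adj , s≤s i′<k ,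
    triple-transfer tail⇔⁻ i i′ k iso

  -- An occurrence either starts at the first letter or lies entirely in the tail.
  avoids-cons : ∀ p → ¬ BeginsWith π p → Avoids τ p → Avoids π p
  avoids-cons (a -[ b · c ]) ¬begins avoids (0F , Fin.suc j , Fin.suc j′ , _ , adj , iso) =
    ¬begins (j , j′ , ℕ.suc-injective adj , iso)
  avoids-cons (a -[ b · c ]) ¬begins avoids
    (Fin.suc i , Fin.suc j , Fin.suc j′ , s≤s i<j , adj , iso) =
    avoids (i , j , j′ , i<j , ℕ.suc-injective adj , triple-transfer tail⇔ i j j′ iso)
  avoids-cons ([ a · b ]- c) ¬begins avoids (0F , Fin.suc i , Fin.suc k , adj , s≤s i<k , iso) =
    ¬begins (i , k , ℕ.suc-injective adj , i<k , iso)
  avoids-cons ([ a · b ]- c) ¬begins avoids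
    (Fin.suc i , Fin.suc i′ , Fin.suc k , adj , s≤s i′<k , iso) =
    avoids (i , i′ , k , ℕ.suc-injective adj , i′<k , triple-transfer tail⇔ i i′ k iso)

avoids-remove : (π : Permutation′ (suc n)) → All (Avoids π) Q → All (Avoids (remove 0F π)) Q
avoids-remove π = All.map λ avoid contains →
  avoid (contains-tail⁻ π (remove 0F π) (punchIn-permute π 0F) _ contains)

-- Beginnings that no occurrence of a pattern can use

begins-letters : (π : Permutation′ (suc n)) → ∀ p → BeginsWith π p →
  ∃[ j ] ∃[ k ] OrderIsomorphic ⟨ letter π 0F , letter π j , letter π k ⟩ (entries p)
begins-letters π (a -[ b · c ]) (j , k , _ , iso)     = Fin.suc j , Fin.suc k , iso
begins-letters π ([ a · b ]- c) (j , k , _ , _ , iso) = Fin.suc j , Fin.suc k , iso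

begins-order : (π : Permutation′ (suc n)) → ∀ p → BeginsWith π p →
  ∃ λ (f : Fin 3 → Fin (suc n)) → f 0F ≡ 0F ×
    (∀ i j → entries p i < entries p j → letter π (f i) < letter π (f j))
begins-order π p begins with begins-letters π p begins
... | x , y , iso = ⟨ 0F , x , y ⟩ , refl , λ i j lt →
  subst₂ _<_ (lookup-triple (letter π) 0F x y i) (lookup-triple (letter π) 0F x y j)
    (Equivalence.from (iso i j) lt)

¬begins-min : (π : Permutation′ (suc n)) → π ⟨$⟩ʳ 0F ≡ 0F →
  (∃ λ i → entries p i < entries p 0F) → ¬ BeginsWith π p
¬begins-min {p = p} π π0≡0 (i , lt) begins with begins-order π p begins
... | f , f0≡0 , order with order i 0F lt
... | lt′ rewrite f0≡0 | π0≡0 = ℕ.n≮0 lt′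

¬begins-max : (π : Permutation′ (suc n)) → π ⟨$⟩ʳ 0F ≡ fromℕ n →
  (∃ λ i → entries p 0F < entries p i) → ¬ BeginsWith π p
¬begins-max {p = p} π π0≡n (i , lt) begins with begins-order π p begins
... | f , f0≡0 , order with order 0F i lt
... | lt′ rewrite f0≡0 | π0≡n = ℕ.<⇒≱ lt′ (Fin.≤fromℕ _)

-- Two entries below the first would require two different values below 1.
¬begins-1 : (π : Permutation′ (suc (suc n))) → π ⟨$⟩ʳ 0F ≡ 1F →
  (∃[ i ] ∃[ j ] entries p i < entries p j × entries p j < entries p 0F) → ¬ BeginsWith π p
¬begins-1 {p = p} π π0≡1 (i , j , lt₁ , lt₂) begins with begins-order π p begins
... | f , f0≡0 , order with order i j lt₁ | order j 0F lt₂
... | lt₁′ | lt₂′ rewrite f0≡0 | π0≡1 = ℕ.n≮0 (ℕ.<-≤-trans lt₁′ (ℕ.s≤s⁻¹ lt₂′))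

-- Adjacency forces the value 0 to play `b`, although `b` is not the least entry.
¬begins-second : (π : Permutation′ (suc (suc n))) → π ⟨$⟩ʳ 1F ≡ 0F → ∀ {a b c} →
  (∃ λ i → ⟨ a , b , c ⟩ i < b) → ¬ BeginsWith π ([ a · b ]- c)
¬begins-second π π1≡0 (i , lt) (0F , k , _ , _ , iso) with Equivalence.from (iso i 1F) lt
... | lt′ rewrite π1≡0 = ℕ.n≮0 lt′

module _ (π : Permutation′ n) where

  injective : ∀ {i j} → π ⟨$⟩ʳ i ≡ π ⟨$⟩ʳ j → i ≡ j
  injective eq = trans (sym (inverseˡ π)) (trans (cong (π ⟨$⟩ˡ_) eq) (inverseˡ π))

  letter-injective : ∀ {i j} → letter π i ≡ letter π j → i ≡ j
  letter-injective = injective ∘ Fin.toℕ-injective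

min<letter : (π : Permutation′ (suc n)) → ∀ {i j} → π ⟨$⟩ʳ i ≡ 0F → i ≢ j →
  letter π i < letter π j
min<letter π {i} {j} πi≡0 i≢j = ℕ.≤∧≢⇒< le (i≢j ∘ letter-injective π)
  where
  le : letter π i ≤ letter π j
  le rewrite πi≡0 = z≤n

letter<max : (π : Permutation′ (suc n)) → ∀ {i j} → π ⟨$⟩ʳ j ≡ fromℕ n → i ≢ j →
  letter π i < letter π j
letter<max π {i} {j} πj≡n i≢j = ℕ.≤∧≢⇒< le (i≢j ∘ letter-injective π)
  where
  le : letter π i ≤ letter π j
  le rewrite πj≡n = Fin.≤fromℕ _

-- If the value 1 plays the letter 2, then the value 0 must play the letter 1; but 0 stands in the
-- second position, while the letter 1 of the pattern comes third or later.
¬begins-2-31 : (π : Permutation′ (suc (suc n))) → π ⟨$⟩ʳ 0F ≡ 1F → π ⟨$⟩ʳ 1F ≡ 0F →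
  ¬ BeginsWith π (2 -[ 3 · 1 ])
¬begins-2-31 π π0≡1 π1≡0 (j , Fin.suc j′ , _ , iso)
  with Equivalence.from (iso 2F 0F) (s≤s (s≤s z≤n)) | min<letter π {j = Fin.suc (Fin.suc j′)} π1≡0 (λ ())
... | lt | pos rewrite π0≡1 | π1≡0 = ℕ.<⇒≱ pos (ℕ.s≤s⁻¹ lt)

-- The Fibonacci recurrence

-- What the recurrence asks of a reversed set. `Fin.suc (top n)` is the one value that may precede
-- the least one; the `suc` makes it differ from 0. `notMin` and `¬begins` make both beginnings
-- harmless, `min-early` and `top-early` show that there are no others.
record Fibonacci (Q : List Pattern) : Set where
  field
    top       : ∀ n → Fin (suc n)
    notMin    : All (λ p → ∃ λ i → entries p i < entries p 0F) Q
    ¬begins   : (π : Permutation′ (suc (suc n))) →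
                π ⟨$⟩ʳ 0F ≡ Fin.suc (top n) → π ⟨$⟩ʳ 1F ≡ 0F →
                All (λ p → ¬ BeginsWith π p) Q
    min-early : (π : Permutation′ (suc (suc n))) → All (Avoids π) Q →
                ∀ i → π ⟨$⟩ʳ Fin.suc (Fin.suc i) ≢ 0F
    top-early : (π : Permutation′ (suc (suc n))) → All (Avoids π) Q → π ⟨$⟩ʳ 1F ≡ 0F →
                ∀ i → π ⟨$⟩ʳ Fin.suc (Fin.suc i) ≢ Fin.suc (top n)

at-most-one-contains : n ≤ 1 → (π : Permutation′ n) → ∀ p → Avoids π p
at-most-one-contains (s≤s z≤n) π (a -[ b · c ]) (_ , 0F , 0F , _ , () , _)
at-most-one-contains (s≤s z≤n) π ([ a · b ]- c) (0F , 0F , _ , () , _)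

-- Both base cases of the recurrence: `F 0` and `F 1` are 1, and the empty permutation is counted
-- for length 0.
at-most-one : n ≤ 1 → ∀ Q → HasCardinality (S n Q) 1
at-most-one {n} n≤1 Q = record
  { to        = λ _ → 0F
  ; from      = λ _ → id , All.universal (at-most-one-contains n≤1 id) Q
  ; to-cong   = λ _ → refl
  ; from-cong = λ _ _ → refl
  ; inverse   = (λ { {0F} _ → refl }) , (λ _ → λ i → unique n≤1 _ _)
  }
  where
  unique : ∀ {n} → n ≤ 1 → (i j : Fin n) → i ≡ j
  unique (s≤s z≤n) 0F 0F = refl

module _ {Q : List Pattern} (fib : Fibonacci Q) where
  open Fibonacci fib

  prepend-min : Setoid.Carrier (S n Q) → Setoid.Carrier (S (suc n) Q)
  prepend-min (π , avoids) = lift₀ π , All.zipWith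
    (λ {p} (notMin , avoid) →
      avoids-cons (lift₀ π) π {0F} (λ _ → refl) p (¬begins-min {p = p} (lift₀ π) refl notMin) avoid)
    (notMin , avoids)

  prepend-top-min : Setoid.Carrier (S n Q) → Setoid.Carrier (S (suc (suc n)) Q)
  prepend-top-min {n} (π , avoids) = σ , All.zipWith
    (λ {p} (¬begin , avoid) → avoids-cons σ (lift₀ π) {Fin.suc (top n)} (λ _ → refl) p ¬begin avoid)
    (¬begins σ refl refl , proj₂ (prepend-min (π , avoids)))
    where
    σ : Permutation′ (suc (suc n))
    -- `lift₀ π` starts with 0, and `punchIn` at a successor fixes 0, so `σ` starts with the
    -- prescribed value followed by 0, both by computation.
    σ = insert 0F (Fin.suc (top n)) (lift₀ π)

  prepend : Setoid.Carrier (S (suc n) Q ⊎ₛ S n Q) → Setoid.Carrier (S (suc (suc n)) Q)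
  prepend (inj₁ x) = prepend-min x
  prepend (inj₂ x) = prepend-top-min x

  prepend-cong : ∀ x y → Setoid._≈_ (S (suc n) Q ⊎ₛ S n Q) x y →
    Setoid._≈_ (S (suc (suc n)) Q) (prepend x) (prepend y)
  prepend-cong _ _ (Pointwise.inj₁ x≈y) 0F          = refl
  prepend-cong _ _ (Pointwise.inj₁ x≈y) (Fin.suc i) = cong Fin.suc (x≈y i)
  prepend-cong _ _ (Pointwise.inj₂ x≈y) 0F                    = refl
  prepend-cong _ _ (Pointwise.inj₂ x≈y) 1F                    = refl
  prepend-cong _ _ (Pointwise.inj₂ x≈y) (Fin.suc (Fin.suc i)) =
    cong (punchIn (Fin.suc (top _)) ∘ Fin.suc) (x≈y i)

  prepend-injective : ∀ x y → Setoid._≈_ (S (suc (suc n)) Q) (prepend x) (prepend y) →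
    Setoid._≈_ (S (suc n) Q ⊎ₛ S n Q) x y
  prepend-injective (inj₁ x) (inj₁ y) eq =
    Pointwise.inj₁ λ i → Fin.suc-injective (eq (Fin.suc i))
  -- The two kinds of beginning differ in the first letter: 0 against a successor.
  prepend-injective (inj₁ x) (inj₂ y) eq = contradiction (eq 0F) λ ()
  prepend-injective (inj₂ x) (inj₁ y) eq = contradiction (eq 0F) λ ()
  prepend-injective (inj₂ x) (inj₂ y) eq = Pointwise.inj₂ λ i →
    Fin.suc-injective (Fin.punchIn-injective (Fin.suc (top _)) _ _ (eq (Fin.suc (Fin.suc i))))

  -- Locate the value 0. In the first position it is deleted; in the second, the prescribed value is
  -- located too, must come first, and both letters are deleted.
  prepend-surjective : ∀ y → ∃ λ x → Setoid._≈_ (S (suc (suc n)) Q) (prepend x) y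
  prepend-surjective {n} (π , avoids)
    with π ⟨$⟩ˡ 0F | inverseʳ π {0F}
  ... | Fin.suc (Fin.suc i) | πi≡0 = contradiction πi≡0 (min-early π avoids i)
  ... | 0F | π0≡0 =
    inj₁ (remove 0F π , avoids-remove π avoids) , lift₀-remove π π0≡0
  ... | 1F | π1≡0 with π ⟨$⟩ˡ Fin.suc (top n) | inverseʳ π {Fin.suc (top n)}
  ...   | Fin.suc (Fin.suc i) | πi≡t = contradiction πi≡t (top-early π avoids π1≡0 i)
  ...   | 1F | π1≡t = contradiction (trans (sym π1≡0) π1≡t) λ ()
  ...   | 0F | π0≡t =
    inj₂ (remove 0F ρ , avoids-remove ρ (avoids-remove π avoids)) , same
    where
    ρ : Permutation′ (suc n)
    ρ = remove 0F π

    πsuc : ∀ i → π ⟨$⟩ʳ Fin.suc i ≡ punchIn (Fin.suc (top n)) (ρ ⟨$⟩ʳ i)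
    πsuc i = trans (punchIn-permute π 0F i) (cong (λ x → punchIn x (ρ ⟨$⟩ʳ i)) π0≡t)

    ρ0≡0 : ρ ⟨$⟩ʳ 0F ≡ 0F
    -- The 0 on the right of `π1≡0` is read as the image of 0 under `punchIn (Fin.suc (top n))`.
    ρ0≡0 = Fin.punchIn-injective (Fin.suc (top n)) _ _ (trans (sym (πsuc 0F)) π1≡0)

    same : insert 0F (Fin.suc (top n)) (lift₀ (remove 0F ρ)) ≈ π
    same 0F          = sym π0≡t
    same (Fin.suc i) = trans
      (cong (punchIn (Fin.suc (top n))) (lift₀-remove ρ ρ0≡0 i))
      (sym (πsuc i))

  -- Prepending is injective and surjective; the resulting bijection is then turned around.
  S-recurrence : ∀ n → Inverse (S (suc (suc n)) Q) (S (suc n) Q ⊎ₛ S n Q)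
  S-recurrence n = Symmetry.inverse (Bijection⇒Inverse record
    { to        = prepend
    ; cong      = λ {x} {y} → prepend-cong x y
    ; bijective = (λ {x} {y} → prepend-injective x y) ,
        Consequences.strictlySurjective⇒surjective
          (S (suc n) Q ⊎ₛ S n Q) (S (suc (suc n)) Q)
          {f = prepend}
          (λ {x} {y} → prepend-cong x y) prepend-surjective
    })

  cardinality : ∀ n → HasCardinality (S n Q) (F n)
  cardinality zero          = at-most-one z≤n Q
  cardinality (suc zero)    = at-most-one (s≤s z≤n) Q
  cardinality (suc (suc n)) =
    Composition.inverse (S-recurrence n)
      (Composition.inverse (cardinality (suc n) ⊎-inverse cardinality n)
        -- The pointwise equality on the sum becomes propositional equality, after which the sum of
        -- the two `Fin` types is `Fin` of `F (suc n) + F n`, which is `F (suc (suc n))` by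
        -- definition.
        (Composition.inverse (Pointwise-≡↔≡ _ _) (↔-sym Fin.+↔⊎)))

  cardinality-reversed : ∀ n → HasCardinality (S n (map rev Q)) (F n)
  cardinality-reversed n = Composition.inverse (S-reverse n Q) (cardinality n)

-- The four sets, reversed

module _ (π : Permutation′ (suc (suc n))) where

  -- The first two letters followed by a later 0 would form 32-1 or 23-1.
  min-early : Avoids π ([ 3 · 2 ]- 1) → Avoids π ([ 2 · 3 ]- 1) →
    ∀ i → π ⟨$⟩ʳ Fin.suc (Fin.suc i) ≢ 0F
  min-early ¬321 ¬231 i πi≡0 with ℕ.<-cmp (letter π 0F) (letter π 1F)
  ... | tri< lt _ _ = ¬231 (0F , 1F , Fin.suc (Fin.suc i) , refl , s≤s (s≤s z≤n) ,
                            iso231 (min<letter π πi≡0 (λ ())) lt)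
  ... | tri≈ _ eq _ = contradiction (letter-injective π eq) λ ()
  ... | tri> _ _ gt = ¬321 (0F , 1F , Fin.suc (Fin.suc i) , refl , s≤s (s≤s z≤n) ,
                            iso321 (min<letter π πi≡0 (λ ())) gt)

  -- Here the pair ends at the 0: the first letter, the letter just before the 0, and the 0 would
  -- form 2-31 or 3-21.
  min-early′ : Avoids π (2 -[ 3 · 1 ]) → Avoids π (3 -[ 2 · 1 ]) →
    ∀ i → π ⟨$⟩ʳ Fin.suc (Fin.suc i) ≢ 0F
  min-early′ ¬231 ¬321 i πi≡0
    -- `Fin.suc (inject₁ i)` is the position just before that of the 0; it is not the first
    -- position, as the 0 is third or later.
    with adj ← sym (cong (suc ∘ suc) (Fin.toℕ-inject₁ i))
       | pos ← min<letter π {j = Fin.suc (inject₁ i)} πi≡0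
                 (λ eq → ℕ.1+n≢n (trans (cong toℕ eq) (cong suc (Fin.toℕ-inject₁ i))))
    with ℕ.<-cmp (letter π 0F) (letter π (Fin.suc (inject₁ i)))
  ... | tri< lt _ _ = ¬231 (0F , Fin.suc (inject₁ i) , Fin.suc (Fin.suc i) , s≤s z≤n , adj ,
                            iso231 (min<letter π πi≡0 (λ ())) lt)
  ... | tri≈ _ eq _ = contradiction (letter-injective π eq) λ ()
  ... | tri> _ _ gt = ¬321 (0F , Fin.suc (inject₁ i) , Fin.suc (Fin.suc i) , s≤s z≤n , adj ,
                            iso321 pos gt)

  -- With 0 second and 1 later, the first letter exceeds 1, and the three form 31-2.
  1-early : Avoids π ([ 3 · 1 ]- 2) → π ⟨$⟩ʳ 1F ≡ 0F →
    ∀ i → π ⟨$⟩ʳ Fin.suc (Fin.suc i) ≢ 1F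
  1-early ¬312 π1≡0 i πi≡1 =
    ¬312 (0F , 1F , Fin.suc (Fin.suc i) , refl , s≤s (s≤s z≤n) ,
          iso312 (min<letter π π1≡0 (λ ())) (ℕ.≤∧≢⇒< 1≤π0 (λ eq → contradiction (letter-injective π eq) λ ())))
    where
    1≤π0 : letter π (Fin.suc (Fin.suc i)) ≤ letter π 0F
    1≤π0 = subst (_≤ letter π 0F) (sym (cong toℕ πi≡1))
      (ℕ.≤-<-trans z≤n (min<letter π {j = 0F} π1≡0 (λ ())))

  -- The first letter, the 0 after it and a later maximum would form 21-3.
  max-early : Avoids π ([ 2 · 1 ]- 3) → π ⟨$⟩ʳ 1F ≡ 0F →
    ∀ i → π ⟨$⟩ʳ Fin.suc (Fin.suc i) ≢ fromℕ (suc n)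
  max-early ¬213 π1≡0 i πi≡n =
    ¬213 (0F , 1F , Fin.suc (Fin.suc i) , refl , s≤s (s≤s z≤n) ,
          iso213 (min<letter π π1≡0 (λ ())) (letter<max π πi≡n (λ ())))

literal-< : ∀ {m n} {_ : True (m ℕ.<? n)} → m < n
literal-< {_} {_} {m<n} = toWitness m<n

fibonacci₁ : Fibonacci ([ 3 · 2 ]- 1 ∷ [ 3 · 1 ]- 2 ∷ [ 2 · 3 ]- 1 ∷ 3 -[ 1 · 2 ] ∷ 3 -[ 2 · 1 ] ∷ [])
fibonacci₁ = record
  { top       = λ _ → 0F
  -- Each witness is the index of the entry 1 of the pattern.
  ; notMin    = (2F , literal-<) ∷ (1F , literal-<) ∷ (2F , literal-<) ∷ (1F , literal-<) ∷ (2F , literal-<) ∷ []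
  ; ¬begins   = λ π π0≡1 π1≡0 →
        -- For a pattern starting with 3, the witnesses are the indices of its entries 1 and 2, in
        -- this order.
        ¬begins-1 {p = [ 3 · 2 ]- 1} π π0≡1 (2F , 1F , literal-< , literal-<)
      ∷ ¬begins-1 {p = [ 3 · 1 ]- 2} π π0≡1 (1F , 2F , literal-< , literal-<)
      ∷ ¬begins-second π π1≡0 (0F , literal-<)
      ∷ ¬begins-1 {p = 3 -[ 1 · 2 ]} π π0≡1 (1F , 2F , literal-< , literal-<)
      ∷ ¬begins-1 {p = 3 -[ 2 · 1 ]} π π0≡1 (2F , 1F , literal-< , literal-<)
      ∷ []
  ; min-early = λ { π (¬32-1 ∷ _ ∷ ¬23-1 ∷ _) → min-early π ¬32-1 ¬23-1 }
  ; top-early = λ { π (_ ∷ ¬31-2 ∷ _) → 1-early π ¬31-2 }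
  }

fibonacci₂ : Fibonacci ([ 3 · 2 ]- 1 ∷ [ 3 · 1 ]- 2 ∷ 2 -[ 3 · 1 ] ∷ 3 -[ 1 · 2 ] ∷ 3 -[ 2 · 1 ] ∷ [])
fibonacci₂ = record
  { top       = λ _ → 0F
  ; notMin    = (2F , literal-<) ∷ (1F , literal-<) ∷ (2F , literal-<) ∷ (1F , literal-<) ∷ (2F , literal-<) ∷ []
  ; ¬begins   = λ π π0≡1 π1≡0 →
        ¬begins-1 {p = [ 3 · 2 ]- 1} π π0≡1 (2F , 1F , literal-< , literal-<)
      ∷ ¬begins-1 {p = [ 3 · 1 ]- 2} π π0≡1 (1F , 2F , literal-< , literal-<)
      ∷ ¬begins-2-31 π π0≡1 π1≡0
      ∷ ¬begins-1 {p = 3 -[ 1 · 2 ]} π π0≡1 (1F , 2F , literal-< , literal-<)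
      ∷ ¬begins-1 {p = 3 -[ 2 · 1 ]} π π0≡1 (2F , 1F , literal-< , literal-<)
      ∷ []
  ; min-early = λ { π (_ ∷ _ ∷ ¬2-31 ∷ _ ∷ ¬3-21 ∷ _) → min-early′ π ¬2-31 ¬3-21 }
  ; top-early = λ { π (_ ∷ ¬31-2 ∷ _) → 1-early π ¬31-2 }
  }

fibonacci₃ : Fibonacci ([ 3 · 2 ]- 1 ∷ [ 3 · 1 ]- 2 ∷ 2 -[ 3 · 1 ] ∷ [ 2 · 3 ]- 1 ∷ 3 -[ 1 · 2 ] ∷ [])
fibonacci₃ = record
  { top       = λ _ → 0F
  ; notMin    = (2F , literal-<) ∷ (1F , literal-<) ∷ (2F , literal-<) ∷ (2F , literal-<) ∷ (1F , literal-<) ∷ []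
  ; ¬begins   = λ π π0≡1 π1≡0 →
        ¬begins-1 {p = [ 3 · 2 ]- 1} π π0≡1 (2F , 1F , literal-< , literal-<)
      ∷ ¬begins-1 {p = [ 3 · 1 ]- 2} π π0≡1 (1F , 2F , literal-< , literal-<)
      ∷ ¬begins-2-31 π π0≡1 π1≡0
      ∷ ¬begins-second π π1≡0 (0F , literal-<)
      ∷ ¬begins-1 {p = 3 -[ 1 · 2 ]} π π0≡1 (1F , 2F , literal-< , literal-<)
      ∷ []
  ; min-early = λ { π (¬32-1 ∷ _ ∷ _ ∷ ¬23-1 ∷ _) → min-early π ¬32-1 ¬23-1 }
  ; top-early = λ { π (_ ∷ ¬31-2 ∷ _) → 1-early π ¬31-2 }
  }

fibonacci₄ : Fibonacci ([ 3 · 2 ]- 1 ∷ 2 -[ 3 · 1 ] ∷ 2 -[ 1 · 3 ] ∷ [ 2 · 1 ]- 3 ∷ [ 2 · 3 ]- 1 ∷ [])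
fibonacci₄ = record
  { top       = fromℕ
  ; notMin    = (2F , literal-<) ∷ (2F , literal-<) ∷ (1F , literal-<) ∷ (1F , literal-<) ∷ (2F , literal-<) ∷ []
  ; ¬begins   = λ π π0≡max π1≡0 →
        -- 32-1 can start at the maximum, so it is excluded by the 0 in second position; the other
        -- four patterns start with 2 and cannot start at the maximum.
        ¬begins-second π π1≡0 (2F , literal-<)
      ∷ ¬begins-max {p = 2 -[ 3 · 1 ]} π π0≡max (1F , literal-<)
      ∷ ¬begins-max {p = 2 -[ 1 · 3 ]} π π0≡max (2F , literal-<)
      ∷ ¬begins-max {p = [ 2 · 1 ]- 3} π π0≡max (2F , literal-<)
      ∷ ¬begins-max {p = [ 2 · 3 ]- 1} π π0≡max (1F , literal-<)
      ∷ []
  ; min-early = λ { π (¬32-1 ∷ _ ∷ _ ∷ _ ∷ ¬23-1 ∷ _) → min-early π ¬32-1 ¬23-1 }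
  ; top-early = λ { π (_ ∷ _ ∷ _ ∷ ¬21-3 ∷ _) → max-early π ¬21-3 }
  }

mainTheorem16 : (P : List Pattern) →
    P ∈ ( (1 -[ 2 · 3 ] ∷ 2 -[ 1 · 3 ] ∷ 1 -[ 3 · 2 ] ∷ [ 2 · 1 ]- 3 ∷ [ 1 · 2 ]- 3 ∷ [])
    ∷ (1 -[ 2 · 3 ] ∷ 2 -[ 1 · 3 ] ∷ [ 1 · 3 ]- 2 ∷ [ 2 · 1 ]- 3 ∷ [ 1 · 2 ]- 3 ∷ [])
    ∷ (1 -[ 2 · 3 ] ∷ 2 -[ 1 · 3 ] ∷ [ 1 · 3 ]- 2 ∷ 1 -[ 3 · 2 ] ∷ [ 2 · 1 ]- 3 ∷ [])
    ∷ (1 -[ 2 · 3 ] ∷ [ 1 · 3 ]- 2 ∷ [ 3 · 1 ]- 2 ∷ 3 -[ 1 · 2 ] ∷ 1 -[ 3 · 2 ] ∷ [])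
    ∷ [] ) →
    (n : ℕ) → 1 ≤ n →
    HasCardinality (S n P) (F n)
mainTheorem16 _ (here refl)                         n _ = cardinality-reversed fibonacci₁ n
mainTheorem16 _ (there (here refl))                 n _ = cardinality-reversed fibonacci₂ n
mainTheorem16 _ (there (there (here refl)))         n _ = cardinality-reversed fibonacci₃ n
mainTheorem16 _ (there (there (there (here refl)))) n _ = cardinality-reversed fibonacci₄ n
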